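{- Let $W=\langle s_0,\dots,s_{n-1}\rangle$ be a finite string C-group, $\mathcal{P}(W)$ the regular polytope with automorphism group $W$, and $N\le W$ such that $\mathcal{P}(W)/N$ is a polytope admitting the flag action of $W$, with $N$ the stabilizer of the base flag $\Phi$. Let $u_1=1,u_2,\dots,u_r\in W$ be chosen so that the flags $\Phi^{u_1},\dots,\Phi^{u_r}$ are representatives of the $r$ orbits of the automorphism group of $\mathcal{P}(W)/N$ on its flags. Let $\sigma_1,\dots,\sigma_t$ be the distinct Coxeter elements of $W$, and let $m_{j,l}=|\{\Phi^{u_j}\alpha : \alpha\in\langle\sigma_l\rangle\}|$, the size of the orbit of $\Phi^{u_j}$ under the flag action of $\langle\sigma_l\rangle$. For $0\le i\le n-1$ let $H_i=\langle s_k : k\ne i\rangle$. If $(\sigma_l)^kH_i\cap N^{u_j}=\emptyset$ for all $i$, $j$, $l$ and all $1\le k<m_{j,l}$, then $\mathcal{P}(W)/N$ has acoptic Petrie schemes.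
   Context: Abstract polytopes are graded posets with least and greatest faces, all flags of equal length, strongly connected, satisfying the diamond condition. A string C-group is generated by distinct involutions $s_0,\dots,s_{n-1}$ with $(s_is_j)^2=1$ for $|i-j|>1$ and the intersection property. The flag action of $W$ on a polytope sends a flag $\Phi$ under $s_i$ to the unique flag $\Phi^{s_i}$ differing from $\Phi$ only in its face of rank $i$ (assumed to extend to a well-defined right action). A Coxeter element of $W$ is a product of the generators $s_0,\dots,s_{n-1}$ in which each generator appears exactly once (in some order). The exchange map $\varrho_i$ sends each flag to the flag differing from it only in rank $i$; a Petrie map $\sigma$ is a composition of $\varrho_0,\dots,\varrho_{n-1}$ with each appearing exactly once (e.g. the flag action of a Coxeter element). A Petrie sequence is a sequence of flags $(\dots,\Phi\sigma^{ -1},\Phi,\Phi\sigma,\Phi\sigma^2,\dots)$ for a fixed Petrie map $\sigma$ and flag $\Phi$; its Petrie scheme is its shortest cyclic listing if the sequence is periodic, and the sequence itself otherwise. A polytope has acoptic Petrie schemes if each proper face (face other than the least and greatest) appears at most once in each Petrie scheme, i.e. among the flags of a Petrie scheme no proper face occurs in two different positions. $N^{u}=u^{ -1}Nu$. -}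

module Defs where

open import Algebra.Bundles using (Group)
import Algebra.Definitions.RawMonoid as RawMonoidDefs
import Algebra.Properties.Group as GroupProperties
open import Data.Fin.Base as Fin using (Fin; zero; suc; toℕ; inject₁)
open import Data.Fin.Permutation using (Permutation′; _⟨$⟩ʳ_)
open import Data.Fin.Properties using (toℕ-injective; toℕ-inject₁; toℕ-fromℕ; toℕ<n)
open import Data.Fin.Relation.Unary.Top using (view; ‵fromℕ; ‵inject₁)
open import Data.Fin.Subset using (Subset; _∈_; ⁅_⁆; ∁) renaming (_∩_ to _∩ˢ_)
open import Data.Fin.Subset.Properties using (x∉p⇒x∈∁p; x∈∁p⇒x∉p; x∈⁅x⁆; x∈⁅y⁆⇒x≡y)
open import Data.Integer.Base as ℤ using (ℤ; +_)
open import Data.Nat.Base using (ℕ; zero; suc; _+_; _≤_; _<_; ∣_-_∣; z≤n; s≤s)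
import Data.Nat.Properties as ℕₚ
open import Data.Product.Base using (Σ; ∃; ∃₂; _×_; _,_; proj₁; proj₂)
open import Data.Sum.Base using (_⊎_)
open import Data.Vec.Functional using (foldl)
open import Function.Base using (_∘_)
open import Function.Bundles using (Inverse)
open import Level using (Level; 0ℓ; _⊔_) renaming (suc to lsuc)
open import Relation.Binary.Bundles using (Setoid; Poset)
open import Relation.Binary.Construct.Closure.ReflexiveTransitive using (Star)
import Relation.Binary.Construct.On as On
open import Relation.Binary.Core using (Rel)
open import Relation.Binary.Definitions using (Minimum; Maximum; tri<; tri≈; tri>)
open import Relation.Binary.Morphism.Structures using (IsOrderIsomorphism)
import Relation.Binary.Properties.Poset as PosetProperties
open import Relation.Binary.PropositionalEquality as ≡ using (_≡_; _≢_)
import Relation.Binary.Reasoning.Setoid as ≈-Reasoning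
open import Relation.Nullary using (¬_; contradiction)
open import Relation.Unary using (Pred; Decidable; _∩_; _≐_; _≬_)

private
  variable
    a b c ℓ p q : Level

_HasSize_ : Setoid a b → ℕ → Set _
S HasSize m = Inverse S (≡.setoid (Fin m))

Finite : Setoid a b → Set _
Finite S = ∃ λ m → S HasSize m

SubSetoid : (S : Setoid a b) → Pred (Setoid.Carrier S) p → Setoid _ _
SubSetoid S X = On.setoid {B = Σ (Setoid.Carrier S) X} S proj₁

------------------------------------------------------------------------
-- Groups

module _ (G : Group c ℓ) where

  open Group G
  open RawMonoidDefs rawMonoid using () renaming (_×_ to _times_; sum to product)

  infixr 8 _^_

  _^_ : Carrier → ℕ → Carrier
  w ^ k = k times w

  ∏ : ∀ {n} → (Fin n → Carrier) → Carrier
  ∏ = product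

  record Subgroup p : Set (c ⊔ ℓ ⊔ lsuc p) where
    field
      member   : Pred Carrier p
      resp     : ∀ {x y} → x ≈ y → member x → member y
      ε-closed : member ε
      ∙-closed : ∀ {x y} → member x → member y → member (x ∙ y)
      ⁻¹-closed : ∀ {x} → member x → member (x ⁻¹)

  data ⟨_⟩ (X : Pred Carrier p) : Pred Carrier (c ⊔ ℓ ⊔ p) where
    gen  : ∀ {x} → X x → ⟨ X ⟩ x
    unit : ⟨ X ⟩ ε
    mul  : ∀ {x y} → ⟨ X ⟩ x → ⟨ X ⟩ y → ⟨ X ⟩ (x ∙ y)
    inv  : ∀ {x} → ⟨ X ⟩ x → ⟨ X ⟩ (x ⁻¹)
    resp : ∀ {x y} → x ≈ y → ⟨ X ⟩ x → ⟨ X ⟩ y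

  LeftCoset : Carrier → Pred Carrier p → Pred Carrier _
  LeftCoset w X z = ∃ λ h → X h × z ≈ w ∙ h

  Conjugate : Pred Carrier p → Carrier → Pred Carrier _
  Conjugate X u z = ∃ λ x → X x × z ≈ u ⁻¹ ∙ x ∙ u

  record RightAction (S : Setoid a b) : Set (a ⊔ b ⊔ c ⊔ ℓ) where
    open Setoid S using () renaming (Carrier to A; _≈_ to _≈ˢ_)
    infixl 7 _·_
    field
      _·_     : A → Carrier → A
      ·-cong  : ∀ {x y g h} → x ≈ˢ y → g ≈ h → x · g ≈ˢ y · h
      ·-ε     : ∀ x → x · ε ≈ˢ x
      ·-assoc : ∀ x g h → x · (g ∙ h) ≈ˢ x · g · h

------------------------------------------------------------------------
-- String C-groups

record StringCGroup c ℓ (n : ℕ) : Set (lsuc (c ⊔ ℓ)) where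
  field
    group : Group c ℓ
  open Group group public
  field
    s : Fin n → Carrier

  Generators : Subset n → Pred Carrier ℓ
  Generators I w = ∃ λ k → k ∈ I × w ≈ s k

  Parabolic : Subset n → Pred Carrier (c ⊔ ℓ)
  Parabolic I = ⟨_⟩ group (Generators I)

  field
    generates    : ∀ w → ⟨_⟩ group (λ x → ∃ λ k → x ≈ s k) w
    distinct     : ∀ {i j} → s i ≈ s j → i ≡ j
    nontrivial   : ∀ i → ¬ s i ≈ ε
    involutive   : ∀ i → s i ∙ s i ≈ ε
    string       : ∀ i j → 1 < ∣ toℕ i - toℕ j ∣ → (s i ∙ s j) ∙ (s i ∙ s j) ≈ ε
    intersection : ∀ I J → (Parabolic I ∩ Parabolic J) ≐ Parabolic (I ∩ˢ J)

  H : Fin n → Pred Carrier (c ⊔ ℓ)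
  H i = Parabolic (∁ ⁅ i ⁆)

  IsCoxeterElement : Pred Carrier ℓ
  IsCoxeterElement w = ∃ λ (π : Permutation′ n) → w ≈ ∏ group (λ k → s (π ⟨$⟩ʳ k))

------------------------------------------------------------------------
-- Abstract polytopes

module _ (P : Poset a b q) where

  open Poset P using (Carrier; _≈_; module Eq) renaming (_≤_ to _≼_)
  open PosetProperties P using () renaming (_<_ to _≺_)

  _⋖_ : Rel Carrier _
  x ⋖ y = x ≺ y × ¬ (∃ λ z → x ≺ z × z ≺ y)

  -- Ranks traditionally start at -1; here they are shifted by one, so that
  -- `rank F` is one more than the usual rank of the face F.
  record IsGraded (n : ℕ) : Set (a ⊔ b ⊔ q) where
    field
      rank          : Carrier → ℕ
      rank-cong     : ∀ {x y} → x ≈ y → rank x ≡ rank y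
      rank-mono     : ∀ {x y} → x ≺ y → rank x < rank y
      rank-cover    : ∀ {x y} → x ⋖ y → rank y ≡ suc (rank x)
      rank-least    : ∀ {x} → Minimum _≼_ x → rank x ≡ 0
      rank-greatest : ∀ {x} → Maximum _≼_ x → rank x ≡ suc n

  IsMaximalChain : Pred Carrier p → Set _
  IsMaximalChain C =
      (∀ {x y} → C x → C y → x ≼ y ⊎ y ≼ x)
    × (∀ z → (∀ {y} → C y → z ≼ y ⊎ y ≼ z) → C z)

  -- All maximal chains of a polytope of rank n have n + 2 faces, so its flags
  -- are exactly the chains of n + 2 faces, listed here in increasing order.
  record Flag (n : ℕ) : Set (a ⊔ b ⊔ q) where
    field
      face       : Fin (2 + n) → Carrier
      increasing : ∀ {k l} → k Fin.< l → face k ≺ face l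

    -- The least face has index 0, so the face of rank i has index i + 1.
    faceOfRank : Fin n → Carrier
    faceOfRank i = face (suc (inject₁ i))

  open Flag

  _∈F_ : ∀ {n} → Carrier → Flag n → Set b
  x ∈F Φ = ∃ λ k → x ≈ face Φ k

  flagSetoid : ℕ → Setoid _ _
  flagSetoid n = record
    { Carrier       = Flag n
    ; _≈_           = λ Φ Ψ → ∀ k → face Φ k ≈ face Ψ k
    ; isEquivalence = record
      { refl  = λ k → Eq.refl
      ; sym   = λ e k → Eq.sym (e k)
      ; trans = λ e f k → Eq.trans (e k) (f k)
      }
    }

  DifferOnlyInRank : ∀ {n} → Fin n → Rel (Flag n) b
  DifferOnlyInRank i Φ Ψ =
      (∀ k → k ≢ suc (inject₁ i) → face Φ k ≈ face Ψ k)
    × ¬ faceOfRank Φ i ≈ faceOfRank Ψ i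

  Between : Carrier → Carrier → Pred Carrier _
  Between F G H = F ≺ H × H ≺ G

  record IsPolytope (n : ℕ) : Set (lsuc 0ℓ ⊔ a ⊔ b ⊔ q) where
    field
      least      : ∃ (Minimum _≼_)
      greatest   : ∃ (Maximum _≼_)
      graded     : IsGraded n
      -- Classically every subset is decidable.  Asking for decidability keeps
      -- the axiom satisfiable constructively.
      flagLength : ∀ (C : Pred Carrier 0ℓ) → Decidable C → IsMaximalChain C →
                   ∃ λ (Φ : Flag n) → C ≐ (_∈F Φ)
    open IsGraded graded public
    field
      -- The section G / F has rank (rank G - rank F - 1), and connectedness
      -- is a condition on sections of rank at least 2 only.
      stronglyConnected : ∀ {F G} → F ≼ G → 3 + rank F ≤ rank G →
                          ∀ (x y : Σ Carrier (Between F G)) →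
                          Star (λ x y → proj₁ x ≼ proj₁ y ⊎ proj₁ y ≼ proj₁ x) x y
      diamond : ∀ {F G} → F ≼ G → rank G ≡ 2 + rank F →
                ∃₂ λ H₁ H₂ → ¬ H₁ ≈ H₂ × Between F G H₁ × Between F G H₂ ×
                  (∀ H → Between F G H → H ≈ H₁ ⊎ H ≈ H₂)

  IsAutomorphism : (Carrier → Carrier) → Set _
  IsAutomorphism = IsOrderIsomorphism _≈_ _≈_ _≼_ _≼_

  SameFlagOrbit : ∀ {n} → Rel (Flag n) _
  SameFlagOrbit Φ Ψ =
    ∃ λ γ → IsAutomorphism γ × (∀ k → γ (face Φ k) ≈ face Ψ k)

  ----------------------------------------------------------------------
  -- Petrie schemes

  module _ {n : ℕ} where

    open Setoid (flagSetoid n) using () renaming (_≈_ to _≈F_)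

    IsExchangeMap : Fin n → (Flag n → Flag n) → Set _
    IsExchangeMap i ϱ = ∀ Φ → DifferOnlyInRank i Φ (ϱ Φ)

    -- Maps act on the right: ϱ (π 0) is applied first.
    IsPetrieMap : (Flag n → Flag n) → Set _
    IsPetrieMap σ =
      ∃₂ λ (ϱ : Fin n → Flag n → Flag n) (π : Permutation′ n) →
        (∀ i → IsExchangeMap i (ϱ i)) ×
        (∀ Φ → σ Φ ≈F foldl (λ Ψ f → f Ψ) Φ (λ k → ϱ (π ⟨$⟩ʳ k)))

    IsPetrieSequence : (Flag n → Flag n) → (ℤ → Flag n) → Set _
    IsPetrieSequence σ Ψ = ∀ k → Ψ (ℤ.suc k) ≈F σ (Ψ k)

    IsPeriod : (ℤ → Flag n) → Pred ℕ _
    IsPeriod Ψ d = 0 < d × (∀ k → Ψ (k ℤ.+ + d) ≈F Ψ k)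

    IsLeastPeriod : (ℤ → Flag n) → Pred ℕ _
    IsLeastPeriod Ψ d = IsPeriod Ψ d × (∀ e → IsPeriod Ψ e → d ≤ e)

    data PetrieScheme (Ψ : ℤ → Flag n) : Set (a ⊔ b ⊔ q) where
      cyclic   : ∀ d → IsLeastPeriod Ψ d → PetrieScheme Ψ
      infinite : ¬ ∃ (IsPeriod Ψ) → PetrieScheme Ψ

    Position : ∀ {Ψ} → PetrieScheme Ψ → Set
    Position (cyclic d _) = Fin d
    Position (infinite _) = ℤ

    flagAt : ∀ {Ψ} (S : PetrieScheme Ψ) → Position S → Flag n
    flagAt {Ψ} (cyclic _ _) k = Ψ (+ toℕ k)
    flagAt {Ψ} (infinite _) k = Ψ k

  IsProperFace : Pred Carrier _
  IsProperFace F = ¬ Minimum _≼_ F × ¬ Maximum _≼_ F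

  HasAcopticPetrieSchemes : ℕ → Set _
  HasAcopticPetrieSchemes n =
    ∀ (σ : Flag n → Flag n) → IsPetrieMap σ →
    ∀ (Ψ : ℤ → Flag n) → IsPetrieSequence σ Ψ →
    ∀ (S : PetrieScheme Ψ) (F : Carrier) → IsProperFace F →
    ∀ (x y : Position S) → F ∈F flagAt S x → F ∈F flagAt S y → x ≡ y

record FlagAction {n} (W : StringCGroup c ℓ n) (P : Poset a b q)
                  : Set (a ⊔ b ⊔ q ⊔ c ⊔ ℓ) where
  open StringCGroup W using (group; s)
  field
    action : RightAction group (flagSetoid P n)
  open RightAction action public
  field
    adjacent : ∀ i Φ → DifferOnlyInRank P i Φ (Φ · s i)

  Orbit : Flag P n → Pred (StringCGroup.Carrier W) p → Pred (Flag P n) _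
  Orbit Φ X Ψ = ∃ λ α → X α × Setoid._≈_ (flagSetoid P n) Ψ (Φ · α)

------------------------------------------------------------------------
-- The regular polytope of a string C-group and its quotients

-- Faces are left cosets w H_i, automorphisms act by left multiplication and
-- the flag action is by right multiplication: s_i sends the flag
-- {w H_0, …, w H_{n-1}} to {w s_i H_0, …, w s_i H_{n-1}}.
module _ {n} (W : StringCGroup c ℓ n) where

  open StringCGroup W
  private
    module GP = GroupProperties group
    open ≈-Reasoning setoid

  data Face : Set c where
    least greatest : Face
    coset          : Fin n → Carrier → Face

  infix 4 _≈ᶠ_ _≤ᶠ_

  data _≈ᶠ_ : Rel Face (c ⊔ ℓ) where
    least    : least ≈ᶠ least
    greatest : greatest ≈ᶠ greatest
    coset    : ∀ {i w v} →
               LeftCoset group w (H i) ≐ LeftCoset group v (H i) →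
               coset i w ≈ᶠ coset i v

  data _≤ᶠ_ : Rel Face (c ⊔ ℓ) where
    least≤    : ∀ {x} → least ≤ᶠ x
    ≤greatest : ∀ {x} → x ≤ᶠ greatest
    coset     : ∀ {i j w v} → i Fin.≤ j →
                LeftCoset group w (H i) ≬ LeftCoset group v (H j) →
                coset i w ≤ᶠ coset j v

  infixr 7 _▷_

  _▷_ : Carrier → Face → Face
  g ▷ least     = least
  g ▷ greatest  = greatest
  g ▷ coset i w = coset i (g ∙ w)

  private
    ≈ᶠ-refl : ∀ {x} → x ≈ᶠ x
    ≈ᶠ-refl {least}     = least
    ≈ᶠ-refl {greatest}  = greatest
    ≈ᶠ-refl {coset i w} = coset ((λ z → z) , (λ z → z))

    ≈ᶠ-sym : ∀ {x y} → x ≈ᶠ y → y ≈ᶠ x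
    ≈ᶠ-sym least           = least
    ≈ᶠ-sym greatest        = greatest
    ≈ᶠ-sym (coset (f , g)) = coset (g , f)

    ≈ᶠ-trans : ∀ {x y z} → x ≈ᶠ y → y ≈ᶠ z → x ≈ᶠ z
    ≈ᶠ-trans least least                       = least
    ≈ᶠ-trans greatest greatest                 = greatest
    ≈ᶠ-trans (coset (f , g)) (coset (f′ , g′)) =
      coset ((λ z → f′ (f z)) , (λ z → g (g′ z)))

    cancel-right : ∀ x y → x ∙ y ∙ y ⁻¹ ≈ x
    cancel-right x y = trans (assoc x y (y ⁻¹)) (trans (∙-congˡ (inverseʳ y)) (identityʳ x))

    cancel-middle : ∀ x y z → x ∙ y ∙ (y ⁻¹ ∙ z) ≈ x ∙ z
    cancel-middle x y z = begin
      x ∙ y ∙ (y ⁻¹ ∙ z) ≈⟨ assoc (x ∙ y) (y ⁻¹) z ⟨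
      x ∙ y ∙ y ⁻¹ ∙ z   ≈⟨ ∙-congʳ (cancel-right x y) ⟩
      x ∙ z              ∎

    self∈ : ∀ {i} w → LeftCoset group w (H i) w
    self∈ w = ε , unit , sym (identityʳ w)

    H-step : ∀ {i w z h} → LeftCoset group w (H i) z → H i h →
             LeftCoset group w (H i) (z ∙ h)
    H-step {h = h} (k , k∈ , e) h∈ =
      k ∙ h , mul k∈ h∈ , trans (∙-congʳ e) (assoc _ k h)

    coset-resp : ∀ {i w z z′} → z ≈ z′ → LeftCoset group w (H i) z →
                 LeftCoset group w (H i) z′
    coset-resp e (h , h∈ , e′) = h , h∈ , trans (sym e) e′

    meet⇒⊆ : ∀ {i w v z} → LeftCoset group w (H i) z → LeftCoset group v (H i) z →
             ∀ {x} → LeftCoset group w (H i) x → LeftCoset group v (H i) x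
    meet⇒⊆ {w = w} {z = z} (h , h∈ , e) z∈v {x} (k , k∈ , e′) =
      coset-resp eq (H-step z∈v (mul (inv h∈) k∈))
      where
      eq : z ∙ (h ⁻¹ ∙ k) ≈ x
      eq = begin
        z ∙ (h ⁻¹ ∙ k)     ≈⟨ ∙-congʳ e ⟩
        w ∙ h ∙ (h ⁻¹ ∙ k) ≈⟨ cancel-middle w h k ⟩
        w ∙ k              ≈⟨ e′ ⟨
        x                  ∎

    meet⇒≈ : ∀ {i w v} → LeftCoset group w (H i) ≬ LeftCoset group v (H i) →
             coset i w ≈ᶠ coset i v
    meet⇒≈ (z , z∈w , z∈v) = coset (meet⇒⊆ z∈w z∈v , meet⇒⊆ z∈v z∈w)

    ≤ᶠ-reflexive : ∀ {x y} → x ≈ᶠ y → x ≤ᶠ y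
    ≤ᶠ-reflexive least             = least≤
    ≤ᶠ-reflexive greatest          = ≤greatest
    ≤ᶠ-reflexive (coset {w = w} (f , g)) = coset ℕₚ.≤-refl (w , self∈ w , f (self∈ w))

    -- Transitivity rests on H_j = ⟨s_k : k < j⟩⟨s_k : k > j⟩, the two factors
    -- commuting elementwise.
    Lower Upper : Fin n → Pred Carrier (c ⊔ ℓ)
    Lower j = ⟨_⟩ group (λ w → ∃ λ k → k Fin.< j × w ≈ s k)
    Upper j = ⟨_⟩ group (λ w → ∃ λ k → j Fin.< k × w ≈ s k)

    Lower⇒H : ∀ {j k} → j Fin.≤ k → ∀ {w} → Lower j w → H k w
    Lower⇒H j≤k (gen (m , m<j , e)) = gen (m , x∉p⇒x∈∁p m∉ , e)
      where m∉ = λ m∈ → ℕₚ.<⇒≢ (ℕₚ.<-≤-trans m<j j≤k) (≡.cong toℕ (x∈⁅y⁆⇒x≡y _ m∈))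
    Lower⇒H j≤k unit       = unit
    Lower⇒H j≤k (mul x y)  = mul (Lower⇒H j≤k x) (Lower⇒H j≤k y)
    Lower⇒H j≤k (inv x)    = inv (Lower⇒H j≤k x)
    Lower⇒H j≤k (resp e x) = resp e (Lower⇒H j≤k x)

    Upper⇒H : ∀ {i j} → i Fin.≤ j → ∀ {w} → Upper j w → H i w
    Upper⇒H i≤j (gen (m , j<m , e)) = gen (m , x∉p⇒x∈∁p m∉ , e)
      where m∉ = λ m∈ → ℕₚ.<⇒≢ (ℕₚ.≤-<-trans i≤j j<m) (≡.cong toℕ (≡.sym (x∈⁅y⁆⇒x≡y _ m∈)))
    Upper⇒H i≤j unit       = unit
    Upper⇒H i≤j (mul x y)  = mul (Upper⇒H i≤j x) (Upper⇒H i≤j y)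
    Upper⇒H i≤j (inv x)    = inv (Upper⇒H i≤j x)
    Upper⇒H i≤j (resp e x) = resp e (Upper⇒H i≤j x)

    Commute : Carrier → Carrier → Set ℓ
    Commute x y = x ∙ y ≈ y ∙ x

    commute-⟨⟩ : ∀ {X : Pred Carrier p} {y} → (∀ {x} → X x → Commute x y) →
                 ∀ {x} → ⟨_⟩ group X x → Commute x y
    commute-⟨⟩ f (gen x∈) = f x∈
    commute-⟨⟩ f unit = trans (identityˡ _) (sym (identityʳ _))
    commute-⟨⟩ {y = y} f (mul {x₁} {x₂} p q) = begin
      x₁ ∙ x₂ ∙ y   ≈⟨ assoc x₁ x₂ y ⟩
      x₁ ∙ (x₂ ∙ y) ≈⟨ ∙-congˡ (commute-⟨⟩ f q) ⟩
      x₁ ∙ (y ∙ x₂) ≈⟨ assoc x₁ y x₂ ⟨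
      x₁ ∙ y ∙ x₂   ≈⟨ ∙-congʳ (commute-⟨⟩ f p) ⟩
      y ∙ x₁ ∙ x₂   ≈⟨ assoc y x₁ x₂ ⟩
      y ∙ (x₁ ∙ x₂) ∎
    commute-⟨⟩ {y = y} f (inv {x} p) = GP.∙-cancelˡ x _ _ (begin
      x ∙ (x ⁻¹ ∙ y) ≈⟨ assoc x (x ⁻¹) y ⟨
      x ∙ x ⁻¹ ∙ y   ≈⟨ ∙-congʳ (inverseʳ x) ⟩
      ε ∙ y          ≈⟨ identityˡ y ⟩
      y              ≈⟨ cancel-right y x ⟨
      y ∙ x ∙ x ⁻¹   ≈⟨ ∙-congʳ (commute-⟨⟩ f p) ⟨
      x ∙ y ∙ x ⁻¹   ≈⟨ assoc x y (x ⁻¹) ⟩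
      x ∙ (y ∙ x ⁻¹) ∎)
    commute-⟨⟩ f (resp e p) = trans (∙-congʳ (sym e)) (trans (commute-⟨⟩ f p) (∙-congˡ e))

    s⁻¹≈s : ∀ i → s i ⁻¹ ≈ s i
    s⁻¹≈s i = sym (GP.inverseˡ-unique (s i) (s i) (involutive i))

    commute-far : ∀ i j → 1 < ∣ toℕ i - toℕ j ∣ → Commute (s i) (s j)
    commute-far i j d = begin
      s i ∙ s j          ≈⟨ GP.inverseˡ-unique _ _ (string i j d) ⟩
      (s i ∙ s j) ⁻¹     ≈⟨ GP.⁻¹-anti-homo-∙ (s i) (s j) ⟩
      s j ⁻¹ ∙ s i ⁻¹    ≈⟨ ∙-cong (s⁻¹≈s j) (s⁻¹≈s i) ⟩
      s j ∙ s i          ∎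

    far : ∀ {i j k : ℕ} → i < j → j < k → 1 < ∣ i - k ∣
    far {zero}  {suc j} {suc k} _       (s≤s j<k) = s≤s (ℕₚ.≤-trans (s≤s z≤n) j<k)
    far {suc i} {suc j} {suc k} (s≤s p) (s≤s q)   = far p q

    Lower-Upper : ∀ {j x y} → Lower j x → Upper j y → Commute x y
    Lower-Upper {j} x∈ y∈ = commute-⟨⟩ gens x∈
      where
      gens : ∀ {x} → (∃ λ k → k Fin.< j × x ≈ s k) → Commute x _
      gens {x} (k , k<j , e) = sym (commute-⟨⟩ gens′ y∈)
        where
        gens′ : ∀ {y} → (∃ λ l → j Fin.< l × y ≈ s l) → Commute y x
        gens′ (l , j<l , e′) = trans (∙-cong e′ e)
          (trans (sym (commute-far k l (far k<j j<l))) (∙-cong (sym e) (sym e′)))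

    factor : ∀ {j w} → H j w → ∃₂ λ x y → Lower j x × Upper j y × w ≈ x ∙ y
    factor {j} (gen {w} (k , k∈ , e)) with ℕₚ.<-cmp (toℕ k) (toℕ j)
    ... | tri< k<j _ _ = w , ε , gen (k , k<j , e) , unit , sym (identityʳ w)
    ... | tri> _ _ j<k = ε , w , unit , gen (k , j<k , e) , sym (identityˡ w)
    ... | tri≈ _ k≡j _ = contradiction
          (≡.subst (λ i → k ∈ ⁅ i ⁆) (toℕ-injective k≡j) (x∈⁅x⁆ k)) (x∈∁p⇒x∉p k∈)
    factor unit = ε , ε , unit , unit , sym (identityˡ ε)
    factor (mul {w₁} {w₂} p q) with factor p | factor q
    ... | x , y , x∈ , y∈ , e | x′ , y′ , x′∈ , y′∈ , e′ =
      x ∙ x′ , y ∙ y′ , mul x∈ x′∈ , mul y∈ y′∈ , (begin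
        w₁ ∙ w₂             ≈⟨ ∙-cong e e′ ⟩
        x ∙ y ∙ (x′ ∙ y′)   ≈⟨ assoc x y (x′ ∙ y′) ⟩
        x ∙ (y ∙ (x′ ∙ y′)) ≈⟨ ∙-congˡ (assoc y x′ y′) ⟨
        x ∙ (y ∙ x′ ∙ y′)   ≈⟨ ∙-congˡ (∙-congʳ (Lower-Upper x′∈ y∈)) ⟨
        x ∙ (x′ ∙ y ∙ y′)   ≈⟨ ∙-congˡ (assoc x′ y y′) ⟩
        x ∙ (x′ ∙ (y ∙ y′)) ≈⟨ assoc x x′ (y ∙ y′) ⟨
        x ∙ x′ ∙ (y ∙ y′)   ∎)
    factor (inv {w} p) with factor p
    ... | x , y , x∈ , y∈ , e =
      x ⁻¹ , y ⁻¹ , inv x∈ , inv y∈ , (begin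
        w ⁻¹         ≈⟨ ⁻¹-cong e ⟩
        (x ∙ y) ⁻¹   ≈⟨ GP.⁻¹-anti-homo-∙ x y ⟩
        y ⁻¹ ∙ x ⁻¹  ≈⟨ Lower-Upper (inv x∈) (inv y∈) ⟨
        x ⁻¹ ∙ y ⁻¹  ∎)
    factor (resp e p) with factor p
    ... | x , y , x∈ , y∈ , e′ = x , y , x∈ , y∈ , trans (sym e) e′

    ≤ᶠ-trans : ∀ {x y z} → x ≤ᶠ y → y ≤ᶠ z → x ≤ᶠ z
    ≤ᶠ-trans least≤    _         = least≤
    ≤ᶠ-trans ≤greatest ≤greatest = ≤greatest
    ≤ᶠ-trans (coset _ _) ≤greatest = ≤greatest
    ≤ᶠ-trans (coset {w = w} {v = v} i≤j (z₁ , z₁∈w , h , h∈ , e₁))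
             (coset {v = u} j≤k (z₂ , (h′ , h′∈ , e₂) , z₂∈u))
      with factor h∈ | factor h′∈
    ... | x , y , x∈ , y∈ , f | x′ , y′ , x′∈ , y′∈ , f′ =
      coset (ℕₚ.≤-trans i≤j j≤k) (v ∙ x ∙ y′ ,
        coset-resp eq₁ (H-step z₁∈w (Upper⇒H i≤j (mul (inv y∈) y′∈))) ,
        coset-resp eq₂ (H-step z₂∈u (Lower⇒H j≤k (mul (inv x′∈) x∈))))
      where
      eq₁ : z₁ ∙ (y ⁻¹ ∙ y′) ≈ v ∙ x ∙ y′
      eq₁ = begin
        z₁ ∙ (y ⁻¹ ∙ y′)          ≈⟨ ∙-congʳ (trans e₁ (∙-congˡ f)) ⟩
        v ∙ (x ∙ y) ∙ (y ⁻¹ ∙ y′) ≈⟨ ∙-congʳ (assoc v x y) ⟨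
        v ∙ x ∙ y ∙ (y ⁻¹ ∙ y′)   ≈⟨ cancel-middle (v ∙ x) y y′ ⟩
        v ∙ x ∙ y′                ∎
      eq₂ : z₂ ∙ (x′ ⁻¹ ∙ x) ≈ v ∙ x ∙ y′
      eq₂ = begin
        z₂ ∙ (x′ ⁻¹ ∙ x)             ≈⟨ ∙-congʳ (trans e₂ (∙-congˡ f′)) ⟩
        v ∙ (x′ ∙ y′) ∙ (x′ ⁻¹ ∙ x)  ≈⟨ ∙-congʳ (∙-congˡ (Lower-Upper x′∈ y′∈)) ⟩
        v ∙ (y′ ∙ x′) ∙ (x′ ⁻¹ ∙ x)  ≈⟨ ∙-congʳ (assoc v y′ x′) ⟨
        v ∙ y′ ∙ x′ ∙ (x′ ⁻¹ ∙ x)    ≈⟨ cancel-middle (v ∙ y′) x′ x ⟩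
        v ∙ y′ ∙ x                   ≈⟨ assoc v y′ x ⟩
        v ∙ (y′ ∙ x)                 ≈⟨ ∙-congˡ (Lower-Upper x∈ y′∈) ⟨
        v ∙ (x ∙ y′)                 ≈⟨ assoc v x y′ ⟨
        v ∙ x ∙ y′                   ∎

    ≤ᶠ-antisym : ∀ {x y} → x ≤ᶠ y → y ≤ᶠ x → x ≈ᶠ y
    ≤ᶠ-antisym least≤    least≤    = least
    ≤ᶠ-antisym ≤greatest ≤greatest = greatest
    ≤ᶠ-antisym (coset i≤j m) (coset j≤i _)
      with ≡.refl ← toℕ-injective (ℕₚ.≤-antisym i≤j j≤i) = meet⇒≈ m

  𝒫 : Poset c (c ⊔ ℓ) (c ⊔ ℓ)
  𝒫 = record
    { Carrier        = Face
    ; _≈_            = _≈ᶠ_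
    ; _≤_            = _≤ᶠ_
    ; isPartialOrder = record
      { isPreorder = record
        { isEquivalence = record { refl = ≈ᶠ-refl ; sym = ≈ᶠ-sym ; trans = ≈ᶠ-trans }
        ; reflexive     = ≤ᶠ-reflexive
        ; trans         = ≤ᶠ-trans
        }
      ; antisym = ≤ᶠ-antisym
      }
    }

  private
    ▷-coset : ∀ g {i w z} → LeftCoset group w (H i) z → LeftCoset group (g ∙ w) (H i) (g ∙ z)
    ▷-coset g {w = w} (h , h∈ , e) = h , h∈ , trans (∙-congˡ e) (sym (assoc g w h))

    ▷-meet : ∀ g {i j w v} → LeftCoset group w (H i) ≬ LeftCoset group v (H j) →
             LeftCoset group (g ∙ w) (H i) ≬ LeftCoset group (g ∙ v) (H j)
    ▷-meet g (z , z∈w , z∈v) = g ∙ z , ▷-coset g z∈w , ▷-coset g z∈v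

    ▷-mono : ∀ g {x y} → x ≤ᶠ y → g ▷ x ≤ᶠ g ▷ y
    ▷-mono g least≤        = least≤
    ▷-mono g ≤greatest     = ≤greatest
    ▷-mono g (coset i≤j m) = coset i≤j (▷-meet g m)

    ▷-cong : ∀ g {x y} → x ≈ᶠ y → g ▷ x ≈ᶠ g ▷ y
    ▷-cong g e = ≤ᶠ-antisym (▷-mono g (≤ᶠ-reflexive e)) (▷-mono g (≤ᶠ-reflexive (≈ᶠ-sym e)))

    coset-cong : ∀ {i w v} → w ≈ v → coset i w ≈ᶠ coset i v
    coset-cong {w = w} e = meet⇒≈ (w , self∈ w , coset-resp (sym e) (self∈ _))

    ▷-ε : ∀ x → ε ▷ x ≈ᶠ x
    ▷-ε least       = least
    ▷-ε greatest    = greatest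
    ▷-ε (coset i w) = coset-cong (identityˡ w)

    ▷-∙ : ∀ g h x → (g ∙ h) ▷ x ≈ᶠ g ▷ h ▷ x
    ▷-∙ g h least       = least
    ▷-∙ g h greatest    = greatest
    ▷-∙ g h (coset i w) = coset-cong (assoc g h w)

    ▷-≈ε : ∀ {g} x → g ≈ ε → g ▷ x ≈ᶠ x
    ▷-≈ε least       e = least
    ▷-≈ε greatest    e = greatest
    ▷-≈ε (coset i w) e = coset-cong (trans (∙-congʳ e) (identityˡ w))

    -- x ≤ y and h y ≤ g x force x and y to have the same rank.
    ▷-antisym : ∀ {g h x y} → x ≤ᶠ y → h ▷ y ≤ᶠ g ▷ x → x ≈ᶠ y
    ▷-antisym {x = least}     {least}     _ _ = least
    ▷-antisym {x = greatest}  {greatest}  _ _ = greatest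
    ▷-antisym {x = coset _ _} {coset _ _} (coset i≤j m) (coset j≤i _)
      with ≡.refl ← toℕ-injective (ℕₚ.≤-antisym i≤j j≤i) = meet⇒≈ m

  module _ (N : Subgroup group p) where

    open Subgroup N using (member; ε-closed; ∙-closed; ⁻¹-closed)

    infix 4 _∼_ _≲_

    _∼_ : Rel Face (c ⊔ ℓ ⊔ p)
    x ∼ y = ∃ λ g → member g × g ▷ x ≈ᶠ y

    _≲_ : Rel Face (c ⊔ ℓ ⊔ p)
    x ≲ y = ∃₂ λ x′ y′ → x ∼ x′ × y ∼ y′ × x′ ≤ᶠ y′

    private
      ∼-refl : ∀ {x} → x ∼ x
      ∼-refl {x} = ε , ε-closed , ▷-ε x

      ∼-sym : ∀ {x y} → x ∼ y → y ∼ x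
      ∼-sym {x} (g , g∈ , e) = g ⁻¹ , ⁻¹-closed g∈ ,
        ≈ᶠ-trans (▷-cong (g ⁻¹) (≈ᶠ-sym e))
          (≈ᶠ-trans (≈ᶠ-sym (▷-∙ (g ⁻¹) g x)) (▷-≈ε x (inverseˡ g)))

      ∼-trans : ∀ {x y z} → x ∼ y → y ∼ z → x ∼ z
      ∼-trans {x} (g , g∈ , e) (h , h∈ , e′) = h ∙ g , ∙-closed h∈ g∈ ,
        ≈ᶠ-trans (▷-∙ h g x) (≈ᶠ-trans (▷-cong h e) e′)

      ≲-trans : ∀ {x y z} → x ≲ y → y ≲ z → x ≲ z
      ≲-trans (x′ , y′ , x∼x′ , y∼y′ , x′≤y′) (y″ , z″ , y∼y″ , z∼z″ , y″≤z″)
        with ∼-trans (∼-sym y∼y″) y∼y′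
      ... | g , g∈ , e = x′ , g ▷ z″ , x∼x′ , ∼-trans z∼z″ (g , g∈ , ≈ᶠ-refl) ,
        ≤ᶠ-trans x′≤y′ (≤ᶠ-trans (≤ᶠ-reflexive (≈ᶠ-sym e)) (▷-mono g y″≤z″))

      ≲-antisym : ∀ {x y} → x ≲ y → y ≲ x → x ∼ y
      ≲-antisym (x′ , y′ , x∼x′ , y∼y′ , x′≤y′) (y″ , x″ , y∼y″ , x∼x″ , y″≤x″)
        with ∼-trans (∼-sym y∼y′) y∼y″ | ∼-trans (∼-sym x∼x′) x∼x″
      ... | h , _ , e | g , _ , f =
        ∼-trans x∼x′ (∼-trans (ε , ε-closed , ≈ᶠ-trans (▷-ε x′) x′≈y′) (∼-sym y∼y′))
        where
        x′≈y′ = ▷-antisym x′≤y′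
          (≤ᶠ-trans (≤ᶠ-reflexive e) (≤ᶠ-trans y″≤x″ (≤ᶠ-reflexive (≈ᶠ-sym f))))

    -- The faces of 𝒫 / N are the N-orbits of faces of 𝒫; an orbit is below
    -- another when some representatives are comparable.
    quotient : Poset c (c ⊔ ℓ ⊔ p) (c ⊔ ℓ ⊔ p)
    quotient = record
      { Carrier        = Face
      ; _≈_            = _∼_
      ; _≤_            = _≲_
      ; isPartialOrder = record
        { isPreorder = record
          { isEquivalence = record { refl = ∼-refl ; sym = ∼-sym ; trans = ∼-trans }
          ; reflexive     = λ {x} {y} x∼y → y , y , x∼y , ∼-refl , ≤ᶠ-reflexive ≈ᶠ-refl
          ; trans         = ≲-trans
          }
        ; antisym = ≲-antisym
        }
      }

    cosetFace : Carrier → Fin (2 + n) → Face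
    cosetFace w zero = least
    cosetFace w (suc k) with view k
    ... | ‵fromℕ     = greatest
    ... | ‵inject₁ i = coset i w

    private
      cosetFace-increasing : ∀ w {k l} → k Fin.< l →
        cosetFace w k ≲ cosetFace w l × ¬ cosetFace w k ∼ cosetFace w l
      cosetFace-increasing w {zero} {suc l} _ with view l
      ... | ‵fromℕ     = (_ , _ , ∼-refl , ∼-refl , least≤) , λ { (_ , _ , ()) }
      ... | ‵inject₁ i = (_ , _ , ∼-refl , ∼-refl , least≤) , λ { (_ , _ , ()) }
      cosetFace-increasing w {suc k} {suc l} (s≤s k<l) with view k | view l
      ... | ‵fromℕ     | _          = contradiction (toℕ<n l)
            (ℕₚ.≤⇒≯ (≡.subst (λ m → suc m ≤ toℕ l) (toℕ-fromℕ n) k<l))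
      ... | ‵inject₁ i | ‵fromℕ     = (_ , _ , ∼-refl , ∼-refl , ≤greatest) , λ { (_ , _ , ()) }
      ... | ‵inject₁ i | ‵inject₁ j =
        (_ , _ , ∼-refl , ∼-refl , coset (ℕₚ.<⇒≤ i<j) (w , self∈ w , self∈ w)) ,
        λ { (_ , _ , coset _) → ℕₚ.<-irrefl ≡.refl i<j }
        where
        i<j : toℕ i < toℕ j
        i<j = ≡.subst₂ _<_ (toℕ-inject₁ i) (toℕ-inject₁ j) k<l

    -- The image in 𝒫 / N of the flag {w H_0, …, w H_{n-1}} of 𝒫.
    cosetFlag : Carrier → Flag quotient n
    cosetFlag w = record { face = cosetFace w ; increasing = cosetFace-increasing w }

    baseFlag : Flag quotient n
    baseFlag = cosetFlag ε

{-# OPTIONS --safe #-}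
module Submission where

-- A Petrie map is the flag action of some Coxeter element σ_l, so a Petrie
-- sequence through a flag Θ is Θ, Θσ_l, Θσ_l², …, and moving Θ to Φ^{u_j} by an
-- automorphism shows that its period is at most m_{j,l}.  Two flags of the
-- scheme with a common face of rank i thus give some 1 ≤ k < m_{j,l} for which
-- Φ^{u_j} and Φ^{u_j σ_l^k} share their faces of rank i.  The faces of Φ^w are
-- the N-orbits of the cosets w H_i, so g u_j = u_j σ_l^k h with g ∈ N and
-- h ∈ H_i, whence σ_l^k h lies in N^{u_j}.

open import Defs
open import Algebra.Bundles using (Group)
import Algebra.Properties.Group as GroupProperties
import Algebra.Properties.Monoid.Mult as MonoidMult
open import Data.Fin.Base as Fin using (Fin; zero; suc; toℕ; inject₁; fromℕ)
open import Data.Fin.Permutation using (_⟨$⟩ʳ_)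
open import Data.Fin.Properties
  using (_≟_; pigeonhole; toℕ<n; toℕ-injective; toℕ-inject₁; toℕ-fromℕ; inject₁-injective; suc-injective)
open import Data.Fin.Relation.Unary.Top using (view; view-inject₁; ‵fromℕ; ‵inject₁)
open import Data.Fin.Subset.Properties using (x∉p⇒x∈∁p; x∈∁p⇒x∉p; x∈⁅x⁆; x∈⁅y⁆⇒x≡y)
open import Data.Integer.Base as ℤ using (ℤ; +_; -[1+_])
import Data.Integer.Properties as ℤₚ
open import Data.Nat.Base using (ℕ; zero; suc; _+_; _∸_; _≤_; _<_; s≤s)
import Data.Nat.Properties as ℕₚ
open import Data.Product.Base using (∃; _×_; _,_; proj₁; proj₂)
open import Data.Sum.Base using (_⊎_; inj₁; inj₂)
open import Data.Vec.Functional using (foldl)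
open import Function.Base using (_∘_)
open import Function.Bundles using (_⇔_; module Inverse; module Equivalence)
open import Level using (Level)
open import Relation.Binary.Bundles using (Setoid; Poset)
open import Relation.Binary.Definitions using (Minimum; Maximum; tri<; tri≈; tri>)
open import Relation.Binary.Morphism.Structures using (module IsOrderIsomorphism)
import Relation.Binary.Properties.Poset as PosetProperties
open import Relation.Binary.PropositionalEquality as ≡ using (_≡_; _≢_)
import Relation.Binary.Reasoning.Setoid as ≈-Reasoning
open import Relation.Nullary using (¬_; contradiction; yes; no)
open import Relation.Unary using (Empty; _∩_)

private
  variable
    a b a′ b′ c ℓ p q : Level

-- Strictly increasing sequences of naturals; induction over the integers.

module _ where
  open ℕₚ.≤-Reasoning

  strictlyIncreasing-lower : ∀ {m} (f : Fin (suc m) → ℕ) → (∀ {k l} → k Fin.< l → f k < f l) →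
                             ∀ k → f zero + toℕ k ≤ f k
  strictlyIncreasing-lower f f-inc zero = ℕₚ.≤-reflexive (ℕₚ.+-identityʳ _)
  strictlyIncreasing-lower {suc m} f f-inc (suc k) = begin
    f zero + suc (toℕ k)  ≡⟨ ℕₚ.+-suc _ _ ⟩
    suc (f zero) + toℕ k  ≤⟨ ℕₚ.+-monoˡ-≤ (toℕ k) (f-inc {zero} {suc zero} (s≤s ℕₚ.≤-refl)) ⟩
    f (suc zero) + toℕ k  ≤⟨ strictlyIncreasing-lower (f ∘ suc) (f-inc ∘ s≤s) k ⟩
    f (suc k)             ∎

  -- Each of the `m - k` steps from `k` to the last index raises the value by at least one; written
  -- with sums to avoid truncated subtraction.
  strictlyIncreasing-upper : ∀ {m} (f : Fin (suc m) → ℕ) → (∀ {k l} → k Fin.< l → f k < f l) →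
                             ∀ k → f k + m ≤ f (fromℕ m) + toℕ k
  strictlyIncreasing-upper {zero}  f f-inc zero = ℕₚ.≤-refl
  strictlyIncreasing-upper {suc m} f f-inc zero = begin
    f zero + suc m                ≡⟨ ℕₚ.+-suc _ _ ⟩
    suc (f zero) + m              ≤⟨ ℕₚ.+-monoˡ-≤ m (f-inc {zero} {suc zero} (s≤s ℕₚ.≤-refl)) ⟩
    f (suc zero) + m              ≤⟨ strictlyIncreasing-upper (f ∘ suc) (f-inc ∘ s≤s) zero ⟩
    f (fromℕ (suc m)) + 0         ∎
  strictlyIncreasing-upper {suc m} f f-inc (suc k) = begin
    f (suc k) + suc m               ≡⟨ ℕₚ.+-suc _ _ ⟩
    suc (f (suc k) + m)             ≤⟨ s≤s (strictlyIncreasing-upper (f ∘ suc) (f-inc ∘ s≤s) k) ⟩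
    suc (f (fromℕ (suc m)) + toℕ k) ≡⟨ ℕₚ.+-suc _ _ ⟨
    f (fromℕ (suc m)) + suc (toℕ k) ∎

  -- With `m + 1` strictly increasing values in the range from `0` to `m` no value can be skipped.
  -- This determines the ranks along a flag.
  strictlyIncreasing⇒≡toℕ : ∀ {m} (f : Fin (suc m) → ℕ) → (∀ {k l} → k Fin.< l → f k < f l) →
                            (∀ k → f k ≤ m) → ∀ k → f k ≡ toℕ k
  strictlyIncreasing⇒≡toℕ {m} f f-inc f≤m k = ℕₚ.≤-antisym
    (ℕₚ.+-cancelʳ-≤ m _ _ (begin
      f k + m              ≤⟨ strictlyIncreasing-upper f f-inc k ⟩
      f (fromℕ m) + toℕ k  ≤⟨ ℕₚ.+-monoˡ-≤ (toℕ k) (f≤m (fromℕ m)) ⟩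
      m + toℕ k            ≡⟨ ℕₚ.+-comm m (toℕ k) ⟩
      toℕ k + m            ∎))
    (ℕₚ.≤-trans (ℕₚ.m≤n+m (toℕ k) (f zero)) (strictlyIncreasing-lower f f-inc k))

+-suc-swap : ∀ i k → i ℤ.+ + suc k ≡ ℤ.suc i ℤ.+ + k
+-suc-swap i k = ≡.trans (≡.sym (ℤₚ.+-assoc i ℤ.1ℤ (+ k)))
                         (≡.cong (ℤ._+ + k) (ℤₚ.+-comm i ℤ.1ℤ))

ℤ-induction : (P : ℤ → Set p) → (∀ k → P k → P (ℤ.suc k)) → (∀ k → P (ℤ.suc k) → P k) →
              ∀ i j → P i → P j
ℤ-induction P up down i j Pi = ≡.subst P i+[j-i]≡j (shift (j ℤ.- i))
  where
  i+[j-i]≡j : i ℤ.+ (j ℤ.- i) ≡ j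
  i+[j-i]≡j = ≡.trans (ℤₚ.+-comm i _) (≡.trans (ℤₚ.+-assoc j (ℤ.- i) i)
    (≡.trans (≡.cong (λ z → j ℤ.+ z) (ℤₚ.+-inverseˡ i)) (ℤₚ.+-identityʳ j)))

  climb : ∀ m k → P k → P (k ℤ.+ + m)
  climb zero    k Pk = ≡.subst P (≡.sym (ℤₚ.+-identityʳ k)) Pk
  climb (suc m) k Pk = ≡.subst P (≡.sym (+-suc-swap k m)) (climb m (ℤ.suc k) (up k Pk))

  descend : ∀ m k → P (k ℤ.+ + m) → P k
  descend zero    k Pk = ≡.subst P (ℤₚ.+-identityʳ k) Pk
  descend (suc m) k Pk = down k (descend m (ℤ.suc k) (≡.subst P (+-suc-swap k m) Pk))

  shift : ∀ d → P (i ℤ.+ d)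
  shift (+ m)    = climb m i Pi
  -- The target lies `suc m` below `i`, so descending from its translate by `suc m` means descending
  -- from `i`.
  shift -[1+ m ] = descend (suc m) _ (≡.subst P (≡.sym (≡.trans
    (ℤₚ.+-assoc i -[1+ m ] (+ suc m))
    (≡.trans (≡.cong (λ z → i ℤ.+ z) (ℤₚ.+-inverseˡ (+ suc m))) (ℤₚ.+-identityʳ i)))) Pi)

-- Group actions

module _ {G : Group c ℓ} {S : Setoid a b} (α : RightAction G S) where

  open Group G using (_∙_; ε; _⁻¹; _≈_; inverseˡ; inverseʳ) renaming (Carrier to C)
  private module G = Group G
  open Setoid S using (refl; sym; trans) renaming (Carrier to A; _≈_ to _≈ˢ_)
  open RightAction α
  open ≈-Reasoning S

  ·-⁻¹-· : ∀ x g → x · g ⁻¹ · g ≈ˢ x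
  ·-⁻¹-· x g = begin
    x · g ⁻¹ · g   ≈⟨ ·-assoc x (g ⁻¹) g ⟨
    x · (g ⁻¹ ∙ g) ≈⟨ ·-cong refl (inverseˡ g) ⟩
    x · ε          ≈⟨ ·-ε x ⟩
    x              ∎

  ·-cancelʳ : ∀ {x y} g → x · g ≈ˢ y · g → x ≈ˢ y
  ·-cancelʳ {x} {y} g e = begin
    x              ≈⟨ ·-·-⁻¹ x ⟨
    x · g · g ⁻¹   ≈⟨ ·-cong e G.refl ⟩
    y · g · g ⁻¹   ≈⟨ ·-·-⁻¹ y ⟩
    y              ∎
    where
    ·-·-⁻¹ : ∀ z → z · g · g ⁻¹ ≈ˢ z
    ·-·-⁻¹ z = begin
      z · g · g ⁻¹   ≈⟨ ·-assoc z g (g ⁻¹) ⟨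
      z · (g ∙ g ⁻¹) ≈⟨ ·-cong refl (inverseʳ g) ⟩
      z · ε          ≈⟨ ·-ε z ⟩
      z              ∎

  ^-generated : ∀ g k → ⟨_⟩ G (g ≈_) (_^_ G g k)
  ^-generated g zero    = unit
  ^-generated g (suc k) = mul (gen G.refl) (^-generated g k)

  -- The `m + 1` points `x · g ^ k` with `k ≤ m` lie in an orbit of size `m`, so two of them
  -- coincide. Cancelling the smaller power leaves their difference as the exponent `e`.
  finite-orbit⇒returns : ∀ x g {m} →
    SubSetoid S (λ y → ∃ λ h → ⟨_⟩ G (g ≈_) h × y ≈ˢ x · h) HasSize m →
    ∃ λ e → 0 < e × e ≤ m × x · _^_ G g e ≈ˢ x
  finite-orbit⇒returns x g {m} size
    with pigeonhole (ℕₚ.n<1+n m)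
           (λ k → Inverse.to size (x · _^_ G g (toℕ k) , _ , ^-generated g (toℕ k) , refl))
  ... | i , j , i<j , eq = toℕ j ∸ toℕ i , ℕₚ.m<n⇒0<n∸m i<j ,
    ℕₚ.≤-trans (ℕₚ.m∸n≤m (toℕ j) (toℕ i)) (ℕₚ.<⇒≤pred (toℕ<n j)) ,
    ·-cancelʳ (g^ toℕ i) (begin
      x · g^ (toℕ j ∸ toℕ i) · g^ toℕ i   ≈⟨ ·-assoc x _ _ ⟨
      x · (g^ (toℕ j ∸ toℕ i) ∙ g^ toℕ i) ≈⟨ ·-cong refl (×-homo-+ g (toℕ j ∸ toℕ i) (toℕ i)) ⟨
      x · g^ (toℕ j ∸ toℕ i + toℕ i)
        ≡⟨ ≡.cong (λ k → x · g^ k) (ℕₚ.m∸n+n≡m (ℕₚ.<⇒≤ i<j)) ⟩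
      x · g^ toℕ j                         ≈⟨ injective (≡.sym eq) ⟩
      x · g^ toℕ i                         ∎)
    where
    open MonoidMult G.monoid using (×-homo-+)
    g^_ = _^_ G g
    injective : ∀ {y z} → Inverse.to size y ≡ Inverse.to size z → proj₁ y ≈ˢ proj₁ z
    injective {y} {z} e = trans (sym (Inverse.strictlyInverseʳ size y)) (Inverse.inverseʳ size e)

  -- In a right action the leftmost factor acts first, and `foldl` applies `f zero` first, so the
  -- order is kept.
  foldl-· : ∀ {m} (f : Fin m → A → A) (g : Fin m → C) → (∀ k x → f k x ≈ˢ x · g k) →
            ∀ x → foldl (λ y h → h y) x f ≈ˢ x · ∏ G g
  foldl-· {zero}  f g f≈g x = sym (·-ε x)
  foldl-· {suc m} f g f≈g x = begin
    foldl (λ y h → h y) (f zero x) (f ∘ suc) ≈⟨ foldl-· (f ∘ suc) (g ∘ suc) (f≈g ∘ suc) _ ⟩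
    f zero x · ∏ G (g ∘ suc)                 ≈⟨ ·-cong (f≈g zero x) G.refl ⟩
    x · g zero · ∏ G (g ∘ suc)               ≈⟨ ·-assoc x (g zero) _ ⟨
    x · ∏ G g                                ∎

  module _ {g : C} (Ψ : ℤ → A) (step : ∀ k → Ψ (ℤ.suc k) ≈ˢ Ψ k · g) where

    sequence-shift : ∀ i k → Ψ (i ℤ.+ + k) ≈ˢ Ψ i · _^_ G g k
    sequence-shift i zero    = begin
      Ψ (i ℤ.+ + 0) ≡⟨ ≡.cong Ψ (ℤₚ.+-identityʳ i) ⟩
      Ψ i           ≈⟨ ·-ε (Ψ i) ⟨
      Ψ i · ε       ∎
    sequence-shift i (suc k) = begin
      Ψ (i ℤ.+ + suc k)        ≡⟨ ≡.cong Ψ (+-suc-swap i k) ⟩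
      Ψ (ℤ.suc i ℤ.+ + k)      ≈⟨ sequence-shift (ℤ.suc i) k ⟩
      Ψ (ℤ.suc i) · _^_ G g k  ≈⟨ ·-cong (step i) G.refl ⟩
      Ψ i · g · _^_ G g k      ≈⟨ ·-assoc (Ψ i) g _ ⟨
      Ψ i · (g ∙ _^_ G g k)    ∎

    -- A return at the single index `i` spreads forwards by acting with `g` and backwards by
    -- cancelling `g`.
    returns⇒periodic : ∀ i e → Ψ i · _^_ G g e ≈ˢ Ψ i → ∀ j → Ψ (j ℤ.+ + e) ≈ˢ Ψ j
    returns⇒periodic i e ret j = ℤ-induction (λ k → Ψ (k ℤ.+ + e) ≈ˢ Ψ k)
      (λ k eq → begin
        Ψ (ℤ.suc k ℤ.+ + e) ≈⟨ step′ k ⟩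
        Ψ (k ℤ.+ + e) · g   ≈⟨ ·-cong eq G.refl ⟩
        Ψ k · g             ≈⟨ step k ⟨
        Ψ (ℤ.suc k)         ∎)
      (λ k eq → ·-cancelʳ g (begin
        Ψ (k ℤ.+ + e) · g   ≈⟨ step′ k ⟨
        Ψ (ℤ.suc k ℤ.+ + e) ≈⟨ eq ⟩
        Ψ (ℤ.suc k)         ≈⟨ step k ⟩
        Ψ k · g             ∎))
      i j (trans (sequence-shift i e) ret)
      where
      step′ : ∀ k → Ψ (ℤ.suc k ℤ.+ + e) ≈ˢ Ψ (k ℤ.+ + e) · g
      step′ k = trans (Setoid.reflexive S (≡.cong Ψ (ℤₚ.+-assoc ℤ.1ℤ k (+ e)))) (step (k ℤ.+ + e))

-- Lets `cosetFlag` be treated as an equivariant map from `W` to the flags of the quotient.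
regularAction : (G : Group c ℓ) → RightAction G (Group.setoid G)
regularAction G = record
  { _·_     = _∙_
  ; ·-cong  = ∙-cong
  ; ·-ε     = identityʳ
  ; ·-assoc = λ x g h → sym (assoc x g h)
  }
  where open Group G

module _ {n} (W : StringCGroup c ℓ n) {S : Setoid a b} {T : Setoid a′ b′}
         (α : RightAction (StringCGroup.group W) S)
         (β : RightAction (StringCGroup.group W) T) where

  open StringCGroup W using (s; generates)
  private
    module W = StringCGroup W
    module S = Setoid S
    module T = Setoid T
    module α = RightAction α
    module β = RightAction β
  open ≈-Reasoning T

  -- Induction on words in the generators. It serves both for automorphisms acting on flags and for
  -- `cosetFlag`.
  equivariant : (f : S.Carrier → T.Carrier) → (∀ {x y} → x S.≈ y → f x T.≈ f y) →
                (∀ i x → f x β.· s i T.≈ f (x α.· s i)) →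
                ∀ w x → f x β.· w T.≈ f (x α.· w)
  equivariant f f-cong f-s w = go (generates w)
    where
    go : ∀ {w} → ⟨_⟩ W.group (λ x → ∃ λ k → x W.≈ s k) w → ∀ x → f x β.· w T.≈ f (x α.· w)
    go {w} (gen (k , e)) x = begin
      f x β.· w     ≈⟨ β.·-cong T.refl e ⟩
      f x β.· s k   ≈⟨ f-s k x ⟩
      f (x α.· s k) ≈⟨ f-cong (α.·-cong S.refl e) ⟨
      f (x α.· w)   ∎
    go unit x = T.trans (β.·-ε (f x)) (f-cong (S.sym (α.·-ε x)))
    go (mul {v} {w} p q) x = begin
      f x β.· (v W.∙ w)   ≈⟨ β.·-assoc (f x) v w ⟩
      f x β.· v β.· w     ≈⟨ β.·-cong (go p x) W.refl ⟩
      f (x α.· v) β.· w   ≈⟨ go q (x α.· v) ⟩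
      f (x α.· v α.· w)   ≈⟨ f-cong (α.·-assoc x v w) ⟨
      f (x α.· (v W.∙ w)) ∎
    -- Acting by `w` on both sides reduces the claim to the induction hypothesis at `x · w ⁻¹`.
    go (inv {w} p) x = ·-cancelʳ β w (begin
      f x β.· w W.⁻¹ β.· w     ≈⟨ ·-⁻¹-· β (f x) w ⟩
      f x                      ≈⟨ f-cong (·-⁻¹-· α x w) ⟨
      f (x α.· w W.⁻¹ α.· w)   ≈⟨ go p (x α.· w W.⁻¹) ⟨
      f (x α.· w W.⁻¹) β.· w   ∎)
    go (resp {v} {w} e p) x = begin
      f x β.· w   ≈⟨ β.·-cong T.refl e ⟨
      f x β.· v   ≈⟨ go p x ⟩
      f (x α.· v) ≈⟨ f-cong (α.·-cong S.refl e) ⟩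
      f (x α.· w) ∎

-- Flags of a polytope

module _ {P : Poset a b q} {n : ℕ} where

  open Flag

  mapFlag : ∀ {γ} → IsAutomorphism P γ → Flag P n → Flag P n
  mapFlag {γ} auto Φ = record
    { face       = γ ∘ face Φ
    ; increasing = λ k<l → let Φk≤Φl , Φk≉Φl = increasing Φ k<l in
                           mono Φk≤Φl , Φk≉Φl ∘ injective
    }
    where open IsOrderIsomorphism auto using (mono; injective)

module _ {P : Poset a b q} {n : ℕ} (polytope : IsPolytope P n) where

  open Poset P using (_≈_; reflexive; module Eq) renaming (_≤_ to _≼_; trans to ≼-trans)
  open PosetProperties P using (≤∧≉⇒<; <-respˡ-≈; <-respʳ-≈)
  open IsPolytope polytope renaming (least to minimum; greatest to maximum)
  open Flag

  private
    ≼⇒rank≤ : ∀ {x y} → x ≼ y → rank x ≤ rank y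
    ≼⇒rank≤ {x} {y} x≼y = ℕₚ.≮⇒≥ λ ry<rx → ℕₚ.<-asym ry<rx
      (rank-mono (≤∧≉⇒< x≼y (ℕₚ.<⇒≢ ry<rx ∘ ≡.sym ∘ rank-cong)))

  -- The `n + 2` ranks increase strictly and are bounded by `suc n`, the rank of the greatest face.
  rank-face : ∀ (Φ : Flag P n) k → rank (face Φ k) ≡ toℕ k
  rank-face Φ = strictlyIncreasing⇒≡toℕ (rank ∘ face Φ) (rank-mono ∘ increasing Φ)
    λ k → let _ , ≤⊤ = maximum in
      ≡.subst (rank (face Φ k) ≤_) (rank-greatest ≤⊤) (≼⇒rank≤ (≤⊤ (face Φ k)))

  face-index-unique : ∀ (Φ Ψ : Flag P n) {k l} → face Φ k ≈ face Ψ l → k ≡ l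
  face-index-unique Φ Ψ {k} {l} e = toℕ-injective
    (≡.trans (≡.sym (rank-face Φ k)) (≡.trans (rank-cong e) (rank-face Ψ l)))

  -- A face other than the least one lies strictly above it and so has positive rank. Equality of
  -- faces is not assumed decidable, hence the double negation, which suffices because properness is
  -- itself a negation.
  rank0⇒¬¬minimum : ∀ {x} → rank x ≡ 0 → ¬ ¬ Minimum _≼_ x
  rank0⇒¬¬minimum {x} rx≡0 ¬min = ℕₚ.<⇒≢ (rank-mono (≤∧≉⇒< (⊥≤ x) ⊥≉x))
      (≡.trans (rank-least ⊥≤) (≡.sym rx≡0))
    where
    ⊥≤ = proj₂ minimum
    ⊥≉x : ¬ proj₁ minimum ≈ x
    ⊥≉x e = ¬min λ y → ≼-trans (reflexive (Eq.sym e)) (⊥≤ y)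

  rank-top⇒¬¬maximum : ∀ {x} → rank x ≡ suc n → ¬ ¬ Maximum _≼_ x
  rank-top⇒¬¬maximum {x} rx≡1+n ¬max = ℕₚ.<⇒≢ (rank-mono (≤∧≉⇒< (≤⊤ x) x≉⊤))
      (≡.trans rx≡1+n (≡.sym (rank-greatest ≤⊤)))
    where
    ≤⊤ = proj₂ maximum
    x≉⊤ : ¬ x ≈ proj₁ maximum
    x≉⊤ e = ¬max λ y → ≼-trans (≤⊤ y) (reflexive (Eq.sym e))

  proper⇒faceOfRank : ∀ {F} → IsProperFace P F → (Φ : Flag P n) → ∀ {k} → F ≈ face Φ k →
                      ∃ λ i → k ≡ suc (inject₁ i)
  proper⇒faceOfRank (¬min , _) Φ {zero} e =
    contradiction ¬min (rank0⇒¬¬minimum (≡.trans (rank-cong e) (rank-face Φ zero)))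
  proper⇒faceOfRank (_ , ¬max) Φ {suc k} e with view k
  ... | ‵inject₁ i = i , ≡.refl
  ... | ‵fromℕ     = contradiction ¬max (rank-top⇒¬¬maximum
    (≡.trans (rank-cong e) (≡.trans (rank-face Φ (suc (fromℕ n))) (≡.cong suc (toℕ-fromℕ n)))))

  -- Rank fixes the index of a face within any flag, so a shared face sits at the same index in
  -- both; properness excludes the two ends.
  common-proper-face : ∀ {F} → IsProperFace P F → (Φ Ψ : Flag P n) → _∈F_ P F Φ → _∈F_ P F Ψ →
                       ∃ λ i → faceOfRank Φ i ≈ faceOfRank Ψ i
  common-proper-face proper Φ Ψ (k , F≈Φk) (l , F≈Ψl)
    with Φk≈Ψl ← Eq.trans (Eq.sym F≈Φk) F≈Ψl
    with ≡.refl ← face-index-unique Φ Ψ Φk≈Ψl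
    with i , ≡.refl ← proper⇒faceOfRank proper Φ F≈Φk
    = i , Φk≈Ψl

  module _ (Φ : Flag P n) (i : Fin n) where

    private
      -- The indices `i` and `i + 2` on either side of index `i + 1`, at which the face of rank `i`
      -- stands.
      below above : Fin (2 + n)
      below = inject₁ (inject₁ i)
      above = suc (suc i)

      below<mid : below Fin.< suc (inject₁ i)
      below<mid = ℕₚ.≤-reflexive (≡.cong suc (toℕ-inject₁ (inject₁ i)))

      mid<above : suc (inject₁ i) Fin.< above
      mid<above = s≤s (s≤s (ℕₚ.≤-reflexive (toℕ-inject₁ i)))

      below≼above : face Φ below ≼ face Φ above
      below≼above = proj₁ (increasing Φ (ℕₚ.<-trans below<mid mid<above))

      rank-above : rank (face Φ above) ≡ 2 + rank (face Φ below)
      rank-above = ≡.trans (rank-face Φ above) (≡.cong (λ k → 2 + k) (≡.sym (≡.trans (rank-face Φ below)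
        (≡.trans (toℕ-inject₁ (inject₁ i)) (toℕ-inject₁ i)))))

      between : (Θ : Flag P n) → (∀ k → k ≢ suc (inject₁ i) → face Φ k ≈ face Θ k) →
                Between P (face Φ below) (face Φ above) (faceOfRank Θ i)
      between Θ Φ≈Θ =
        <-respˡ-≈ (Eq.sym (Φ≈Θ below (ℕₚ.<⇒≢ below<mid ∘ ≡.cong toℕ))) (increasing Θ below<mid) ,
        <-respʳ-≈ (Eq.sym (Φ≈Θ above (ℕₚ.<⇒≢ mid<above ∘ ≡.cong toℕ ∘ ≡.sym))) (increasing Θ mid<above)

      -- `G` and `K` both take whichever of `H₁`, `H₂` is left over by `F`.
      pigeonhole₂ : ∀ {F G K H₁ H₂} → ¬ F ≈ G → ¬ F ≈ K →
                    F ≈ H₁ ⊎ F ≈ H₂ → G ≈ H₁ ⊎ G ≈ H₂ → K ≈ H₁ ⊎ K ≈ H₂ → G ≈ K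
      pigeonhole₂ _   _   _        (inj₁ y) (inj₁ z) = Eq.trans y (Eq.sym z)
      pigeonhole₂ _   _   _        (inj₂ y) (inj₂ z) = Eq.trans y (Eq.sym z)
      pigeonhole₂ F≉G _   (inj₁ x) (inj₁ y) (inj₂ _) = contradiction (Eq.trans x (Eq.sym y)) F≉G
      pigeonhole₂ _   F≉K (inj₁ x) (inj₂ _) (inj₁ z) = contradiction (Eq.trans x (Eq.sym z)) F≉K
      pigeonhole₂ _   F≉K (inj₂ x) (inj₁ _) (inj₂ z) = contradiction (Eq.trans x (Eq.sym z)) F≉K
      pigeonhole₂ F≉G _   (inj₂ x) (inj₂ y) (inj₁ _) = contradiction (Eq.trans x (Eq.sym y)) F≉G

    -- By the diamond condition only two faces lie between the neighbours of the face of rank `i` in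
    -- `Φ`; one belongs to `Φ`, so `Ψ` and `Ω` share the other.
    adjacent-unique : ∀ Ψ Ω → DifferOnlyInRank P i Φ Ψ → DifferOnlyInRank P i Φ Ω →
                      ∀ k → face Ψ k ≈ face Ω k
    adjacent-unique Ψ Ω (Φ≈Ψ , Φ≉Ψ) (Φ≈Ω , Φ≉Ω) k with k ≟ suc (inject₁ i)
    ... | no k≢i = Eq.trans (Eq.sym (Φ≈Ψ k k≢i)) (Φ≈Ω k k≢i)
    ... | yes ≡.refl with _ , _ , _ , _ , _ , split ← diamond below≼above rank-above =
      pigeonhole₂ Φ≉Ψ Φ≉Ω (split _ (between Φ (λ _ _ → Eq.refl)))
        (split _ (between Ψ Φ≈Ψ)) (split _ (between Ω Φ≈Ω))

  module _ (Ψ : ℤ → Flag P n)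
    (periods : ∀ a → ∃ λ e → IsPeriod P Ψ e ×
      (∀ i k → 1 ≤ k → k < e → ¬ faceOfRank (Ψ a) i ≈ faceOfRank (Ψ (a ℤ.+ + k)) i)) where

    private
      -- The period `e` given by `periods` at `x` need not be least, but `d ≤ e`, so the gap between
      -- `x` and `y`, being below `d`, is also below `e`.
      unrepeated : ∀ {d F} → IsLeastPeriod P Ψ d → IsProperFace P F → (x y : Fin d) →
                   toℕ x < toℕ y → _∈F_ P F (Ψ (+ toℕ x)) → ¬ _∈F_ P F (Ψ (+ toℕ y))
      unrepeated {F = F} (_ , d-least) proper x y x<y x∈ y∈ =
        let e , period , distinct = periods (+ toℕ x)
            k = toℕ y ∸ toℕ x
            i , eq = common-proper-face proper (Ψ (+ toℕ x)) (Ψ (+ toℕ x ℤ.+ + k)) x∈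
              (≡.subst (λ z → _∈F_ P F (Ψ (+ z))) (≡.sym (ℕₚ.m+[n∸m]≡n (ℕₚ.<⇒≤ x<y))) y∈)
        in distinct i k (ℕₚ.m<n⇒0<n∸m x<y)
             (ℕₚ.≤-<-trans (ℕₚ.m∸n≤m (toℕ y) (toℕ x)) (ℕₚ.<-≤-trans (toℕ<n y) (d-least e period)))
             eq

    faces-in-scheme-distinct : (S : PetrieScheme P Ψ) → ∀ F → IsProperFace P F → ∀ x y →
      _∈F_ P F (flagAt P S x) → _∈F_ P F (flagAt P S y) → x ≡ y
    -- `periods` exhibits a period, so the scheme must be cyclic.
    faces-in-scheme-distinct (infinite aperiodic) _ _ _ _ _ _ =
      contradiction (let e , period , _ = periods (+ 0) in e , period) aperiodic
    faces-in-scheme-distinct (cyclic d leastPeriod) F proper x y x∈ y∈ with ℕₚ.<-cmp (toℕ x) (toℕ y)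
    ... | tri< x<y _ _ = contradiction y∈ (unrepeated leastPeriod proper x y x<y x∈)
    ... | tri≈ _ x≡y _ = toℕ-injective x≡y
    ... | tri> _ _ y<x = contradiction x∈ (unrepeated leastPeriod proper y x y<x y∈)

-- Flag actions

module _ {n} {W : StringCGroup c ℓ n} {P : Poset a b q}
         (polytope : IsPolytope P n) (flagAction : FlagAction W P) where

  open StringCGroup W using (s; H; group; IsCoxeterElement) renaming (refl to ≈-refl)
  private module W = StringCGroup W
  open Poset P using (_≈_; module Eq)
  open Flag
  open FlagAction flagAction
  open Setoid (flagSetoid P n) using () renaming (_≈_ to _≈F_; refl to ≈F-refl)

  -- For a generator `s i`, both flags are `i`-adjacent to the image of `Φ`, hence equal.
  automorphism-equivariant : ∀ {γ} (auto : IsAutomorphism P γ) w Φ →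
                             mapFlag auto Φ · w ≈F mapFlag auto (Φ · w)
  automorphism-equivariant {γ} auto =
    equivariant W action action (mapFlag auto) (λ e k → γ-cong (e k)) λ i Φ →
      let off-i , at-i = adjacent i Φ in
      adjacent-unique polytope (mapFlag auto Φ) i (mapFlag auto Φ · s i) (mapFlag auto (Φ · s i))
        (adjacent i (mapFlag auto Φ))
        ((λ k k≢i → γ-cong (off-i k k≢i)) , at-i ∘ injective)
    where open IsOrderIsomorphism auto using (injective) renaming (cong to γ-cong)

  -- Each generator of `H i` is some `s k` with `k ≢ i`, which changes only the face of rank `k`.
  H-fixes-face : ∀ {i h} → H i h → ∀ Φ → faceOfRank (Φ · h) i ≈ faceOfRank Φ i
  H-fixes-face {i} (gen {h} (k , k∈ , e)) Φ = Eq.trans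
    (·-cong {Φ} {Φ} (≈F-refl {Φ}) e (suc (inject₁ i)))
    (Eq.sym (proj₁ (adjacent k Φ) (suc (inject₁ i)) i≢k))
    where
    i≢k : suc (inject₁ i) ≢ suc (inject₁ k)
    i≢k eq with ≡.refl ← inject₁-injective (suc-injective eq) = x∈∁p⇒x∉p k∈ (x∈⁅x⁆ k)
  H-fixes-face unit Φ = ·-ε Φ _
  H-fixes-face (mul {g} {h} p q) Φ = Eq.trans (·-assoc Φ g h _)
    (Eq.trans (H-fixes-face q (Φ · g)) (H-fixes-face p Φ))
  H-fixes-face (inv {h} p) Φ = Eq.trans (Eq.sym (H-fixes-face p _)) (·-⁻¹-· action Φ h _)
  H-fixes-face (resp {g} {h} e p) Φ = Eq.trans
    (Eq.sym (·-cong {Φ} {Φ} (≈F-refl {Φ}) e _)) (H-fixes-face p Φ)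

  -- Adjacent flags are unique, so every exchange map is the action of the corresponding generator;
  -- the same permutation then orders the Coxeter element.
  petrieMap⇒coxeter : ∀ {τ} → IsPetrieMap P τ → ∃ λ w → IsCoxeterElement w × (∀ Φ → τ Φ ≈F Φ · w)
  petrieMap⇒coxeter {τ} (ϱ , π , exchange , τ≈ϱ) = ∏ group generator , (π , ≈-refl) , λ Φ k →
    Eq.trans (τ≈ϱ Φ k) (foldl-· action (λ j → ϱ (π ⟨$⟩ʳ j)) generator exchange≈· Φ k)
    where
    generator = λ j → s (π ⟨$⟩ʳ j)

    exchange≈· : ∀ j Φ → ϱ (π ⟨$⟩ʳ j) Φ ≈F Φ · generator j
    exchange≈· j Φ = adjacent-unique polytope Φ i (ϱ i Φ) (Φ · s i) (exchange i Φ) (adjacent i Φ)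
      where i = π ⟨$⟩ʳ j

  module _ {Φ Ψ : Flag P n} (same : SameFlagOrbit P Φ Ψ) where

    private
      γ = proj₁ same
      auto = proj₁ (proj₂ same)
      γΦ≈Ψ = proj₂ (proj₂ same)
    open IsOrderIsomorphism auto using (injective) renaming (cong to γ-cong)

    -- Transports returns from `Φ` to `Ψ` and, by injectivity of `γ`, shared faces from `Ψ` back to
    -- `Φ`.
    sameOrbit-· : ∀ w k → γ (face (Φ · w) k) ≈ face (Ψ · w) k
    sameOrbit-· w k = Eq.trans (Eq.sym (automorphism-equivariant auto w Φ k))
      (·-cong {mapFlag auto Φ} {Ψ} γΦ≈Ψ ≈-refl k)

    sameOrbit-fixed : ∀ w → Φ · w ≈F Φ → Ψ · w ≈F Ψ
    sameOrbit-fixed w fixed k =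
      Eq.trans (Eq.sym (sameOrbit-· w k)) (Eq.trans (γ-cong (fixed k)) (γΦ≈Ψ k))

    sameOrbit-common-face : ∀ w i → faceOfRank Ψ i ≈ faceOfRank (Ψ · w) i →
                            faceOfRank Φ i ≈ faceOfRank (Φ · w) i
    sameOrbit-common-face w i e =
      injective (Eq.trans (γΦ≈Ψ _) (Eq.trans e (Eq.sym (sameOrbit-· w _))))

  -- Provides what `faces-in-scheme-distinct` asks for at `a`: the return exponent of `Φ`, at most
  -- `m`, becomes a period of `Ψ`, and a face repeated sooner would be repeated along the orbit of
  -- `Φ`.
  sequence-period : ∀ {w m} (Ψ : ℤ → Flag P n) → (∀ k → Ψ (ℤ.suc k) ≈F Ψ k · w) →
    ∀ a Φ → SameFlagOrbit P Φ (Ψ a) →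
    SubSetoid (flagSetoid P n) (Orbit Φ (⟨_⟩ group (w W.≈_))) HasSize m →
    (∀ i k → 1 ≤ k → k < m → ¬ faceOfRank Φ i ≈ faceOfRank (Φ · _^_ group w k) i) →
    ∃ λ e → IsPeriod P Ψ e ×
      (∀ i k → 1 ≤ k → k < e → ¬ faceOfRank (Ψ a) i ≈ faceOfRank (Ψ (a ℤ.+ + k)) i)
  sequence-period {w} Ψ step a Φ same size distinct =
    let e , 0<e , e≤m , returns = finite-orbit⇒returns action Φ w size in
    e ,
    (0<e , returns⇒periodic action Ψ step a e (sameOrbit-fixed same (_^_ group w e) returns)) ,
    λ i k 1≤k k<e eq → distinct i k 1≤k (ℕₚ.<-≤-trans k<e e≤m)
      (sameOrbit-common-face same (_^_ group w k) i
        (Eq.trans eq (sequence-shift action Ψ step a k _)))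

-- Cosets, coset flags and the flag action on the quotient.

module _ {n} (W : StringCGroup c ℓ n) (N : Subgroup (StringCGroup.group W) p) where

  open StringCGroup W
  open Subgroup N using (ε-closed) renaming (member to N∋_)
  private
    module GP = GroupProperties group
    Q = quotient W N
    Φ = baseFlag W N
  open Flag
  open Poset Q using (module Eq) renaming (_≈_ to _∼ᶠ_)

  coset-∼⇒ : ∀ {i v w} → coset i v ∼ᶠ coset i w → ∃ λ g → N∋ g × ∃ λ h → H i h × g ∙ v ≈ w ∙ h
  -- `g ∙ v` lies in its own coset, hence in the coset of `w`.
  coset-∼⇒ (g , g∈ , coset (f , _)) = g , g∈ , f (ε , unit , sym (identityʳ _))

  -- The cosets already coincide in `𝒫`, so `ε` serves as the element of `N`.
  ⇒coset-∼ : ∀ {i v w h} → H i h → w ≈ v ∙ h → coset i v ∼ᶠ coset i w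
  ⇒coset-∼ {i} {v} {w} {h} h∈ w≈vh = ε , ε-closed , coset (to , from)
    where
    open ≈-Reasoning setoid
    to : ∀ {z} → LeftCoset group (ε ∙ v) (H i) z → LeftCoset group w (H i) z
    to {z} (k , k∈ , e) = h ⁻¹ ∙ k , mul (inv h∈) k∈ , (begin
      z                  ≈⟨ e ⟩
      ε ∙ v ∙ k          ≈⟨ ∙-congʳ (identityˡ v) ⟩
      v ∙ k              ≈⟨ ∙-congˡ (GP.\\-leftDividesˡ h k) ⟨
      v ∙ (h ∙ (h ⁻¹ ∙ k)) ≈⟨ assoc v h _ ⟨
      v ∙ h ∙ (h ⁻¹ ∙ k) ≈⟨ ∙-congʳ w≈vh ⟨
      w ∙ (h ⁻¹ ∙ k)     ∎)
    from : ∀ {z} → LeftCoset group w (H i) z → LeftCoset group (ε ∙ v) (H i) z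
    from {z} (k , k∈ , e) = h ∙ k , mul h∈ k∈ , (begin
      z               ≈⟨ e ⟩
      w ∙ k           ≈⟨ ∙-congʳ w≈vh ⟩
      v ∙ h ∙ k       ≈⟨ assoc v h k ⟩
      v ∙ (h ∙ k)     ≈⟨ ∙-congʳ (identityˡ v) ⟨
      ε ∙ v ∙ (h ∙ k) ∎)

  -- `cosetFace` is defined through `view`, which does not reduce at `inject₁ i` for a variable `i`.
  faceOfRank-cosetFlag : ∀ w i → faceOfRank (cosetFlag W N w) i ≡ coset i w
  faceOfRank-cosetFlag w i rewrite view-inject₁ i = ≡.refl

  -- The hypothesis concerns only the rank at index `k`, so the lemma also covers adjacent flags,
  -- where one rank is excluded.
  cosetFlag-agree : ∀ {v w} k → (∀ i → k ≡ suc (inject₁ i) → coset i v ∼ᶠ coset i w) →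
                    cosetFace W N v k ∼ᶠ cosetFace W N w k
  cosetFlag-agree zero    _ = Eq.refl
  cosetFlag-agree (suc k) e with view k
  ... | ‵fromℕ     = Eq.refl
  ... | ‵inject₁ i = e i ≡.refl

  cosetFlag-cong : ∀ {v w} → v ≈ w → ∀ k → cosetFace W N v k ∼ᶠ cosetFace W N w k
  cosetFlag-cong v≈w k = cosetFlag-agree k
    λ i _ → ⇒coset-∼ unit (trans (sym v≈w) (sym (identityʳ _)))

  module _ (polytope : IsPolytope Q n) (flagAction : FlagAction W Q) where

    open FlagAction flagAction
    open Setoid (flagSetoid Q n) using () renaming (_≈_ to _≈F_; refl to ≈F-refl)

    module _ (N-fixes : ∀ {g} → N∋ g → Φ · g ≈F Φ) where

      -- Otherwise g v = v s_i h with g ∈ N and h ∈ H_i, so Φ^v = Φ^{v s_i h},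
      -- whose face of rank i is that of Φ^{v s_i}, not that of Φ^v.
      coset-≁-adjacent : ∀ i v → ¬ coset i v ∼ᶠ coset i (v ∙ s i)
      coset-≁-adjacent i v eq with g , g∈ , h , h∈ , gv≈vsh ← coset-∼⇒ eq =
        proj₂ (adjacent i (Φ · v)) (begin
          faceOfRank (Φ · v) i              ≈⟨ ·-cong {Φ · g} {Φ} (N-fixes g∈) refl _ ⟨
          faceOfRank (Φ · g · v) i          ≈⟨ ·-assoc Φ g v _ ⟨
          faceOfRank (Φ · (g ∙ v)) i        ≈⟨ ·-cong {Φ} {Φ} (≈F-refl {Φ}) gv≈vsh _ ⟩
          faceOfRank (Φ · (v ∙ s i ∙ h)) i  ≈⟨ ·-assoc Φ (v ∙ s i) h _ ⟩
          faceOfRank (Φ · (v ∙ s i) · h) i  ≈⟨ H-fixes-face polytope flagAction h∈ (Φ · (v ∙ s i)) ⟩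
          faceOfRank (Φ · (v ∙ s i)) i      ≈⟨ ·-assoc Φ v (s i) _ ⟩
          faceOfRank (Φ · v · s i) i        ∎)
        where open ≈-Reasoning (Poset.Eq.setoid Q)

      -- For `j ≢ i` the generator `s i` lies in `H j`, so passing from `v` to `v ∙ s i` keeps the
      -- coset of rank `j`.
      cosetFlag-adjacent : ∀ i v → DifferOnlyInRank Q i (cosetFlag W N v) (cosetFlag W N (v ∙ s i))
      cosetFlag-adjacent i v =
        (λ k k≢i → cosetFlag-agree k λ j k≡j → ⇒coset-∼
          (gen (i , x∉p⇒x∈∁p (λ i∈ → k≢i (≡.trans k≡j (≡.cong (suc ∘ inject₁) (≡.sym (x∈⁅y⁆⇒x≡y j i∈))))) , refl))
          refl) ,
        λ e → coset-≁-adjacent i v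
          (≡.subst₂ _∼ᶠ_ (faceOfRank-cosetFlag v i) (faceOfRank-cosetFlag (v ∙ s i) i) e)

      -- Identifies the given flag action on coset flags with right multiplication: for a generator
      -- both sides are `i`-adjacent to the same flag.
      cosetFlag-· : ∀ w v → cosetFlag W N v · w ≈F cosetFlag W N (v ∙ w)
      cosetFlag-· = equivariant W (regularAction group) action (cosetFlag W N) cosetFlag-cong λ i v →
        adjacent-unique polytope (cosetFlag W N v) i (cosetFlag W N v · s i) (cosetFlag W N (v ∙ s i))
          (adjacent i (cosetFlag W N v)) (cosetFlag-adjacent i v)

      faceOfRank-orbit : ∀ w i → faceOfRank (Φ · w) i ∼ᶠ coset i w
      faceOfRank-orbit w i = Eq.trans (cosetFlag-· w ε _) (Eq.trans (cosetFlag-cong (identityˡ w) _)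
        (Eq.reflexive (faceOfRank-cosetFlag w i)))

      common-face⇒∼ : ∀ {i} v w → faceOfRank (Φ · v) i ∼ᶠ faceOfRank (Φ · w) i →
                      coset i v ∼ᶠ coset i w
      common-face⇒∼ {i} v w e = begin
        coset i v             ≈⟨ faceOfRank-orbit v i ⟨
        faceOfRank (Φ · v) i  ≈⟨ e ⟩
        faceOfRank (Φ · w) i  ≈⟨ faceOfRank-orbit w i ⟩
        coset i w             ∎
        where open ≈-Reasoning (Poset.Eq.setoid Q)

      common-face⇒conjugate : ∀ {i} u w → faceOfRank (Φ · u) i ∼ᶠ faceOfRank (Φ · u · w) i →
        ∃ (LeftCoset group w (H i) ∩ Conjugate group N∋_ u)
      common-face⇒conjugate {i} u w e =
        let g , g∈ , h , h∈ , gu≈uwh = coset-∼⇒ (common-face⇒∼ u (u ∙ w)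
              (Eq.trans e (Eq.sym (·-assoc Φ u w (suc (inject₁ i))))))
        -- The common element is `w ∙ h`, obtained by solving `g ∙ u ≈ u ∙ w ∙ h` for it.
        in w ∙ h , (h , h∈ , refl) , g , g∈ , (begin
          w ∙ h                ≈⟨ GP.\\-leftDividesʳ u (w ∙ h) ⟨
          u ⁻¹ ∙ (u ∙ (w ∙ h)) ≈⟨ ∙-congˡ (assoc u w h) ⟨
          u ⁻¹ ∙ (u ∙ w ∙ h)   ≈⟨ ∙-congˡ gu≈uwh ⟨
          u ⁻¹ ∙ (g ∙ u)       ≈⟨ assoc (u ⁻¹) g u ⟨
          u ⁻¹ ∙ g ∙ u         ∎)
        where open ≈-Reasoning setoid

theorem7 :
  ∀ {c ℓ p : Level} {n : ℕ} (W : StringCGroup c ℓ n) →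
  let open StringCGroup W in
  Finite setoid →
  (N : Subgroup group p) →
  let open Subgroup N using () renaming (member to N∋_)
      Q = quotient W N
      Φ = baseFlag W N
      open Setoid (flagSetoid Q n) using () renaming (_≈_ to _≈F_)
  in
  IsPolytope Q n →
  (flagAction : FlagAction W Q) →
  let open FlagAction flagAction in
  (∀ w → (N∋ w) ⇔ (Φ · w ≈F Φ)) →
  (r : ℕ) (u : Fin (suc r) → Carrier) →
  u zero ≈ ε →
  (∀ Ψ → ∃ λ j → SameFlagOrbit Q (Φ · u j) Ψ) →
  (∀ j j′ → SameFlagOrbit Q (Φ · u j) (Φ · u j′) → j ≡ j′) →
  (t : ℕ) (σ : Fin t → Carrier) →
  (∀ l → IsCoxeterElement (σ l)) →
  (∀ w → IsCoxeterElement w → ∃ λ l → w ≈ σ l) →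
  (∀ l l′ → σ l ≈ σ l′ → l ≡ l′) →
  (m : Fin (suc r) → Fin t → ℕ) →
  (∀ j l → SubSetoid (flagSetoid Q n) (Orbit (Φ · u j) (⟨_⟩ group (σ l ≈_))) HasSize m j l) →
  (∀ i j l k → 1 ≤ k → k < m j l →
    Empty (LeftCoset group (_^_ group (σ l) k) (H i) ∩ Conjugate group N∋_ (u j))) →
  HasAcopticPetrieSchemes Q n
theorem7 {n = n} W _ N polytope flagAction stabilizer r u _ represent _ t σ _ complete _ m size disjoint
         τ petrie Ψ sequence =
  let w , coxeter , τ≈w = petrieMap⇒coxeter polytope flagAction {τ} petrie
      l , w≈σl = complete w coxeter
  in faces-in-scheme-distinct polytope Ψ λ a →
       -- The representative `j`, and with it the bound `m j l`, is chosen separately for each start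
       -- `a`.
       let j , same = represent (Ψ a) in
       sequence-period polytope flagAction {σ l} Ψ
         (λ k i → Eq.trans (sequence k i) (Eq.trans (τ≈w (Ψ k) i)
           (·-cong {Ψ k} {Ψ k} (≈F-refl {Ψ k}) w≈σl i)))
         a (Φ · u j) same (size j l)
         λ i k 1≤k k<m e → let z , z∈ = common-face⇒conjugate W N polytope flagAction
                                 (λ {g} → Equivalence.to (stabilizer g)) (u j) (_^_ group (σ l) k) e
                           in disjoint i j l k 1≤k k<m z z∈
  where
  open StringCGroup W using (group)
  open FlagAction flagAction
  Q = quotient W N
  Φ = baseFlag W N
  open Poset Q using (module Eq)
  open Setoid (flagSetoid Q n) using () renaming (refl to ≈F-refl)
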